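{- Let $G=(V,E,\iota)$ be a finite loopless multi-graph. Then $G$ admits a proper edge colouring $\phi:E\to\{1,2,3,\dots\}$ which is local, i.e. for every edge $e$ with end-points $x,y$, $$\phi(e)\le \max\{d(x)+\pi(x),\; d(y)+\pi(y)\}.$$
   Context: A multi-graph $G=(V,E,\iota)$ consists of a vertex set $V$, an edge set $E$ and a (not necessarily injective) map $\iota:E\to\binom{V}{2}$ assigning to each edge an unordered pair of distinct end-points. For distinct $x,y\in V$, $\pi(x,y)=|\iota^{ -1}(\{x,y\})|$ is the multiplicity of the pair. The degree of $x$ is $d(x)=\sum_{y\neq x}\pi(x,y)$, and $\pi(x)=\max_{y\neq x}\pi(x,y)$ is the maximum edge multiplicity at $x$. An edge colouring is proper if no two distinct edges sharing an end-point receive the same colour. -}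

module Defs where

open import Data.Nat using (ℕ; zero; suc; _+_; _⊔_; _≤_)
open import Data.Fin using (Fin)
open import Data.Fin.Properties using (_≟_)
open import Data.Bool using (Bool; true; false; _∧_; _∨_)
open import Data.Product using (_×_)
open import Relation.Nullary using (¬_)
open import Relation.Nullary.Decidable using (⌊_⌋)
open import Relation.Binary.PropositionalEquality using (_≡_; _≢_)

sumFin : (k : ℕ) → (Fin k → ℕ) → ℕ
sumFin zero    f = 0
sumFin (suc k) f = f Fin.zero + sumFin k (λ i → f (Fin.suc i))

maxFin : (k : ℕ) → (Fin k → ℕ) → ℕ
maxFin zero    f = 0
maxFin (suc k) f = f Fin.zero ⊔ maxFin k (λ i → f (Fin.suc i))

-- A finite loopless multigraph with vertex set Fin n and edge set Fin m.
-- The map ι : E → (V choose 2) is represented by two end-point maps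
-- (an unordered pair {end₁ e, end₂ e}) with distinct ends.
record MultiGraph (n m : ℕ) : Set where
  field
    end₁ end₂ : Fin m → Fin n
    loopless  : (e : Fin m) → end₁ e ≢ end₂ e

module _ {n m : ℕ} (G : MultiGraph n m) where
  open MultiGraph G

  joins : Fin m → Fin n → Fin n → Bool
  joins e x y = (⌊ end₁ e ≟ x ⌋ ∧ ⌊ end₂ e ≟ y ⌋) ∨ (⌊ end₁ e ≟ y ⌋ ∧ ⌊ end₂ e ≟ x ⌋)

  mult : Fin n → Fin n → ℕ
  mult x y = sumFin m (λ e → if joins e x y then 1 else 0)
    where open import Data.Bool using (if_then_else_)

  offDiag : Fin n → (Fin n → ℕ) → Fin n → ℕ
  offDiag x f y with x ≟ y
  ... | Relation.Nullary.yes _ = 0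
  ... | Relation.Nullary.no  _ = f y

  deg : Fin n → ℕ
  deg x = sumFin n (offDiag x (mult x))

  -- π(x) = max_{y ≠ x} π(x,y)   (0 if there is no other vertex)
  maxMult : Fin n → ℕ
  maxMult x = maxFin n (offDiag x (mult x))

  shareEnd : Fin m → Fin m → Set
  shareEnd e f = end₁ e ≡ end₁ f ⊎' (end₁ e ≡ end₂ f ⊎' (end₂ e ≡ end₁ f ⊎' end₂ e ≡ end₂ f))
    where open import Data.Sum using () renaming (_⊎_ to _⊎'_)

  Proper : (Fin m → ℕ) → Set
  Proper φ = (e f : Fin m) → e ≢ f → shareEnd e f → φ e ≢ φ f

  Local : (Fin m → ℕ) → Set
  Local φ = (e : Fin m) →
    φ e ≤ (deg (end₁ e) + maxMult (end₁ e)) ⊔ (deg (end₂ e) + maxMult (end₂ e))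

  Positive : (Fin m → ℕ) → Set
  Positive φ = (e : Fin m) → 1 ≤ φ e

{-# OPTIONS --safe #-}
module Submission where

open import Defs
open import Data.Bool using (if_then_else_; T; _∧_)
open import Data.Bool.Properties using (T-∧; T-∨)
open import Data.Nat using (ℕ; zero; suc; _+_; _∸_; _≤_; _<_; _⊔_; z≤n; s≤s)
open import Data.Nat.Properties as ℕₚ hiding (_≟_)
open import Data.Fin using (Fin; toℕ; fromℕ<)
open import Data.Fin.Properties as Finₚ using (_≟_; any?; toℕ<n; toℕ-fromℕ<)
open import Data.Product using (Σ; ∃; _×_; _,_; proj₁; proj₂) renaming (swap to ×-swap)
open import Data.Sum as Sum using (_⊎_; inj₁; inj₂)
open import Data.Vec.Functional using (updateAt)
open import Data.Vec.Functional.Properties using (updateAt-updates; updateAt-minimal)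
open import Function using (_∘_; const; Equivalence)
open import Relation.Nullary using (Dec; yes; no; does; ¬_; ¬?; contradiction; _×-dec_; _⊎-dec_)
open import Relation.Nullary.Decidable as Dec using (T?; ⌊_⌋; fromWitness)
open import Relation.Binary.PropositionalEquality using (_≡_; _≢_; refl; sym; trans; cong; subst; ≢-sym; module ≡-Reasoning)
open import Algebra.Properties.CommutativeSemigroup +-commutativeSemigroup using (interchange)

-- Let bound v = d(v) + π(v), and let the value of a proper partial colouring be the number of
-- pairs (v, γ) with 1 ≤ γ ≤ bound v such that γ occurs at v. A coloured edge that violates
-- locality contributes nothing and may be erased, so it suffices to increase the value
-- whenever some edge is uncoloured. Locality is thus never required along the way.
--
-- An uncoloured edge at x starts a Vizing fan: every edge e at x reserves a colour c e ≤ bound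
-- missing at its other end (different colours for parallel edges), and each edge of the fan
-- is followed by the edge at x coloured c e. Shifting colours along the fan never lowers
-- the value. If the fan cannot be continued, its last edge can be coloured. If a reserved
-- colour β repeats, then for a colour α missing at x some α/β-chain can be swapped so that
-- one of the shifted fan edges can be coloured. Two vertices gain a colour that counts, and
-- since the interior vertices of a chain keep both colours, only its far end may lose one.

-- Finite sums and counting.

sumFin-mono : ∀ k {f g : Fin k → ℕ} → (∀ i → f i ≤ g i) → sumFin k f ≤ sumFin k g
sumFin-mono zero    f≤g = z≤n
sumFin-mono (suc k) f≤g = +-mono-≤ (f≤g Fin.zero) (sumFin-mono k (f≤g ∘ Fin.suc))

sumFin-+ : ∀ k (f g : Fin k → ℕ) → sumFin k (λ i → f i + g i) ≡ sumFin k f + sumFin k g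
sumFin-+ zero    f g = refl
sumFin-+ (suc k) f g =
  trans (cong (f Fin.zero + g Fin.zero +_) (sumFin-+ k (f ∘ Fin.suc) (g ∘ Fin.suc)))
        (interchange (f Fin.zero) (g Fin.zero) _ _)

sumFin-0 : ∀ k → sumFin k (λ _ → 0) ≡ 0
sumFin-0 zero    = refl
sumFin-0 (suc k) = sumFin-0 k

sumFin-swap : ∀ k l (f : Fin k → Fin l → ℕ) →
  sumFin k (λ i → sumFin l (f i)) ≡ sumFin l (λ j → sumFin k (λ i → f i j))
sumFin-swap zero    l f = sym (sumFin-0 l)
sumFin-swap (suc k) l f =
  trans (cong (sumFin l (f Fin.zero) +_) (sumFin-swap k l (f ∘ Fin.suc)))
        (sym (sumFin-+ l _ _))

≤-sumFin : ∀ {k} (f : Fin k → ℕ) i → f i ≤ sumFin k f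
≤-sumFin f Fin.zero    = m≤m+n _ _
≤-sumFin f (Fin.suc i) = ≤-trans (≤-sumFin (f ∘ Fin.suc) i) (m≤n+m _ _)

≤-maxFin : ∀ {k} (f : Fin k → ℕ) i → f i ≤ maxFin k f
≤-maxFin f Fin.zero    = m≤m⊔n _ _
≤-maxFin f (Fin.suc i) = ≤-trans (≤-maxFin (f ∘ Fin.suc) i) (m≤n⊔m _ _)

-- Uses does rather than ⌊_⌋, so that count (λ e → T? (joins G e x y)) is
-- definitionally mult G x y.
bit : {A : Set} → Dec A → ℕ
bit a? = if does a? then 1 else 0

bit-mono : {A B : Set} (a? : Dec A) (b? : Dec B) → (A → B) → bit a? ≤ bit b?
bit-mono (no _)  b?       f = z≤n
bit-mono (yes a) (yes _)  f = ≤-refl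
bit-mono (yes a) (no ¬b)  f = contradiction (f a) ¬b

count : {k : ℕ} {P : Fin k → Set} → (∀ i → Dec (P i)) → ℕ
count {k} P? = sumFin k (bit ∘ P?)

count-mono : ∀ {k} {P Q : Fin k → Set} (P? : ∀ i → Dec (P i)) (Q? : ∀ i → Dec (Q i)) →
  (∀ i → P i → Q i) → count P? ≤ count Q?
count-mono P? Q? P⊆Q = sumFin-mono _ (λ i → bit-mono (P? i) (Q? i) (P⊆Q i))

count-none : ∀ {k} {P : Fin k → Set} (P? : ∀ i → Dec (P i)) → (∀ i → ¬ P i) → count P? ≡ 0
count-none {zero}  P? ¬P = refl
count-none {suc k} P? ¬P with P? Fin.zero
... | yes p = contradiction p (¬P Fin.zero)
... | no  _ = count-none (P? ∘ Fin.suc) (¬P ∘ Fin.suc)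

count-≟ : ∀ {k} (j : Fin k) → count (_≟ j) ≡ 1
count-≟ {suc k} Fin.zero = cong suc (count-none {k} (λ i → Fin.suc i ≟ Fin.zero) (λ _ ()))
count-≟ {suc k} (Fin.suc j) = trans
  (≤-antisym (count-mono (λ i → Fin.suc i ≟ Fin.suc j) (_≟ j) (λ _ → Finₚ.suc-injective))
             (count-mono (_≟ j) (λ i → Fin.suc i ≟ Fin.suc j) (λ _ → cong Fin.suc)))
  (count-≟ j)

count-complement : ∀ {k} {P : Fin k → Set} (P? : ∀ i → Dec (P i)) → count P? + count (¬? ∘ P?) ≡ k
count-complement {zero}  P? = refl
count-complement {suc k} P? with P? Fin.zero
... | yes _ = cong suc (count-complement (P? ∘ Fin.suc))
... | no  _ = trans (+-suc _ _) (cong suc (count-complement (P? ∘ Fin.suc)))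

count-positive : ∀ {k} {P : Fin k → Set} (P? : ∀ i → Dec (P i)) → 1 ≤ count P? → ∃ P
count-positive {k} P? 1≤ with any? P?
... | yes ∃P = ∃P
... | no  ∄P = contradiction (≤-trans 1≤ (≤-reflexive (count-none P? (λ i p → ∄P (i , p))))) λ ()

count-< : ∀ {k} {P Q : Fin k → Set} (P? : ∀ i → Dec (P i)) (Q? : ∀ i → Dec (Q i)) →
  (∀ i → P i → Q i) → ∀ j → ¬ P j → Q j → suc (count P?) ≤ count Q?
count-< {k} P? Q? P⊆Q j ¬Pj Qj = begin
  suc (count P?)                             ≡⟨ cong (_+ count P?) (count-≟ j) ⟨
  count (_≟ j) + count P?                    ≡⟨ sumFin-+ k _ _ ⟨
  sumFin k (λ i → bit (i ≟ j) + bit (P? i))  ≤⟨ sumFin-mono k pointwise ⟩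
  count Q?                                   ∎
  where
  open ≤-Reasoning
  pointwise : ∀ i → bit (i ≟ j) + bit (P? i) ≤ bit (Q? i)
  pointwise i with i ≟ j
  ... | no _ = bit-mono (P? i) (Q? i) (P⊆Q i)
  ... | yes refl with P? i | Q? i
  ... | yes p | _     = contradiction p ¬Pj
  ... | no _  | yes _ = ≤-refl
  ... | no _  | no ¬q = contradiction Qj ¬q

count-≤-suc : ∀ {k} {P Q : Fin k → Set} (P? : ∀ i → Dec (P i)) (Q? : ∀ i → Dec (Q i)) →
  ∀ j → (∀ i → i ≢ j → P i → Q i) → count P? ≤ suc (count Q?)
count-≤-suc {k} P? Q? j P⊆Q = begin
  count P?                                   ≤⟨ sumFin-mono k pointwise ⟩
  sumFin k (λ i → bit (i ≟ j) + bit (Q? i))  ≡⟨ sumFin-+ k _ _ ⟩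
  count (_≟ j) + count Q?                    ≡⟨ cong (_+ count Q?) (count-≟ j) ⟩
  suc (count Q?)                             ∎
  where
  open ≤-Reasoning
  pointwise : ∀ i → bit (P? i) ≤ bit (i ≟ j) + bit (Q? i)
  pointwise i with i ≟ j
  ... | no i≢j = bit-mono (P? i) (Q? i) (P⊆Q i i≢j)
  ... | yes _ with P? i
  ... | yes _ = s≤s z≤n
  ... | no _  = z≤n

_∖_ : ∀ {k} {Q : Fin k → Set} → (∀ i → Dec (Q i)) → ∀ j i → Dec (Q i × i ≢ j)
(Q? ∖ j) i = Q? i ×-dec ¬? (i ≟ j)

-- Induction on the domain: the image of the first index is deleted from `Q?`, and injectivity keeps
-- the other indices inside what remains.
count-injection : ∀ {k l} {P : Fin k → Set} {Q : Fin l → Set}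
  (P? : ∀ i → Dec (P i)) (Q? : ∀ i → Dec (Q i))
  (g : ∀ i → P i → Fin l) → (∀ i p → Q (g i p)) →
  (∀ i i′ p p′ → g i p ≡ g i′ p′ → i ≡ i′) → count P? ≤ count Q?
count-injection {zero}  P? Q? g gQ inj = z≤n
count-injection {suc k} P? Q? g gQ inj with P? Fin.zero
... | no _ = count-injection (P? ∘ Fin.suc) Q? (g ∘ Fin.suc) (gQ ∘ Fin.suc)
               (λ i i′ p p′ → Finₚ.suc-injective ∘ inj _ _ p p′)
... | yes p₀ = ≤-trans
  (s≤s (count-injection (P? ∘ Fin.suc) (Q? ∖ g Fin.zero p₀) (g ∘ Fin.suc)
    (λ i p → gQ (Fin.suc i) p , λ eq → contradiction (inj _ _ p p₀ eq) λ ())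
    (λ i i′ p p′ → Finₚ.suc-injective ∘ inj _ _ p p′)))
  (count-< (Q? ∖ g Fin.zero p₀) Q? (λ _ → proj₁) (g Fin.zero p₀) (λ q → proj₂ q refl) (gQ _ p₀))

-- Greedy choice, deleting each chosen element of `Q`. Values are shifted by one because they serve
-- as colours and 0 is reserved for uncoloured edges.
injection-from-count : ∀ {k l} {P : Fin k → Set} {Q : Fin l → Set}
  (P? : ∀ i → Dec (P i)) (Q? : ∀ i → Dec (Q i)) → count P? ≤ count Q? →
  Σ (Fin k → ℕ) λ c →
    (∀ i → P i → ∃ λ j → Q j × c i ≡ suc (toℕ j)) ×
    (∀ i i′ → P i → P i′ → c i ≡ c i′ → i ≡ i′)
injection-from-count {zero} P? Q? _ = (λ ()) , (λ ()) , λ ()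
injection-from-count {suc k} {l} {P} {Q} P? Q? le with P? Fin.zero
... | no ¬p₀ with injection-from-count (P? ∘ Fin.suc) Q? le
...   | c , cQ , inj = c′ , c′Q , inj′
  where
  c′ : Fin (suc k) → ℕ
  c′ Fin.zero    = 0
  c′ (Fin.suc i) = c i
  c′Q : ∀ i → P i → ∃ λ j → Q j × c′ i ≡ suc (toℕ j)
  c′Q Fin.zero    p = contradiction p ¬p₀
  c′Q (Fin.suc i) p = cQ i p
  inj′ : ∀ i i′ → P i → P i′ → c′ i ≡ c′ i′ → i ≡ i′
  inj′ Fin.zero    _            p _  _  = contradiction p ¬p₀
  inj′ (Fin.suc i) Fin.zero     _ p′ _  = contradiction p′ ¬p₀
  inj′ (Fin.suc i) (Fin.suc i′) p p′ eq = cong Fin.suc (inj i i′ p p′ eq)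
injection-from-count {suc k} {l} {P} {Q} P? Q? le | yes p₀
  with count-positive Q? (≤-trans (s≤s z≤n) le)
... | j₀ , q₀ with injection-from-count (P? ∘ Fin.suc) (Q? ∖ j₀)
                     (≤-pred (≤-trans le (count-≤-suc Q? (Q? ∖ j₀) j₀ (λ _ i≢ q → q , i≢))))
...   | c , cQ , inj = c′ , c′Q , inj′
  where
  c′ : Fin (suc k) → ℕ
  c′ Fin.zero    = suc (toℕ j₀)
  c′ (Fin.suc i) = c i
  c′Q : ∀ i → P i → ∃ λ j → Q j × c′ i ≡ suc (toℕ j)
  c′Q Fin.zero    p = j₀ , q₀ , refl
  c′Q (Fin.suc i) p with cQ i p
  ... | j , (q , _) , eq = j , q , eq
  fresh : ∀ i → P (Fin.suc i) → suc (toℕ j₀) ≢ c i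
  fresh i p eq with cQ i p
  ... | j , (_ , j≢j₀) , eq′ = j≢j₀ (sym (Finₚ.toℕ-injective (suc-injective (trans eq eq′))))
  inj′ : ∀ i i′ → P i → P i′ → c′ i ≡ c′ i′ → i ≡ i′
  inj′ Fin.zero    Fin.zero     _ _  _  = refl
  inj′ Fin.zero    (Fin.suc i′) _ p′ eq = contradiction eq (fresh i′ p′)
  inj′ (Fin.suc i) Fin.zero     p _  eq = contradiction (sym eq) (fresh i p)
  inj′ (Fin.suc i) (Fin.suc i′) p p′ eq = cong Fin.suc (inj i i′ p p′ eq)

-- A unit gained at `y` pays for a unit lost at `z`: with the indicator of `y` added on the left and
-- that of `z` on the right, the sums compare term by term.
sumFin-exchange-≤ : ∀ {k} {f g : Fin k → ℕ} (y z : Fin k) →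
  suc (f y) ≤ g y → f z ≤ suc (g z) → (∀ v → v ≢ y → v ≢ z → f v ≤ g v) →
  sumFin k f ≤ sumFin k g
sumFin-exchange-≤ {k} {f} {g} y z gain loss rest = +-cancelˡ-≤ 1 _ _ (begin
  1 + sumFin k f                        ≡⟨ cong (_+ sumFin k f) (count-≟ y) ⟨
  count (_≟ y) + sumFin k f             ≡⟨ sumFin-+ k _ _ ⟨
  sumFin k (λ v → bit (v ≟ y) + f v)    ≤⟨ sumFin-mono k pointwise ⟩
  sumFin k (λ v → bit (v ≟ z) + g v)    ≡⟨ sumFin-+ k _ _ ⟩
  count (_≟ z) + sumFin k g             ≡⟨ cong (_+ sumFin k g) (count-≟ z) ⟩
  1 + sumFin k g                        ∎)
  where
  open ≤-Reasoning
  pointwise : ∀ v → bit (v ≟ y) + f v ≤ bit (v ≟ z) + g v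
  pointwise v with v ≟ y | v ≟ z
  ... | yes refl | yes _    = ≤-trans gain (n≤1+n _)
  ... | yes refl | no _     = gain
  ... | no _     | yes refl = loss
  ... | no v≢y   | no v≢z   = rest v v≢y v≢z

-- The gain at `q` pays for the loss at `z`, and the gain at `p` gives strictness. If `z` is `p` or
-- `q`, the gain there rules out a loss.
sumFin-exchange-< : ∀ {k} {f g : Fin k → ℕ} (p q z : Fin k) → p ≢ q →
  suc (f p) ≤ g p → suc (f q) ≤ g q → (∀ v → v ≢ p → v ≢ q → f v ≤ suc (g v)) →
  (∀ v → v ≢ p → v ≢ q → v ≢ z → f v ≤ g v) → sumFin k f < sumFin k g
sumFin-exchange-< {k} {f} {g} p q z p≢q gainp gainq loss rest = begin
  1 + sumFin k f                        ≡⟨ cong (_+ sumFin k f) (count-≟ p) ⟨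
  count (_≟ p) + sumFin k f             ≡⟨ sumFin-+ k _ _ ⟨
  sumFin k (λ v → bit (v ≟ p) + f v)    ≤⟨ sumFin-exchange-≤ q z gain′ loss′ rest′ ⟩
  sumFin k g                            ∎
  where
  open ≤-Reasoning
  h : Fin k → ℕ
  h v = bit (v ≟ p) + f v
  gain′ : suc (h q) ≤ g q
  gain′ with q ≟ p
  ... | yes q≡p = contradiction (sym q≡p) p≢q
  ... | no _    = gainq
  loss′ : h z ≤ suc (g z)
  loss′ with z ≟ p
  ... | yes refl = ≤-trans gainp (n≤1+n _)
  ... | no z≢p with z ≟ q
  ... | yes refl = ≤-trans (n≤1+n _) (≤-trans gainq (n≤1+n _))
  ... | no z≢q   = loss z z≢p z≢q
  rest′ : ∀ v → v ≢ q → v ≢ z → h v ≤ g v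
  rest′ v v≢q v≢z with v ≟ p
  ... | yes refl = gainp
  ... | no v≢p   = rest v v≢p v≢q v≢z

sumFin-< : ∀ {k} {f g : Fin k → ℕ} (y : Fin k) →
  suc (f y) ≤ g y → (∀ v → v ≢ y → f v ≤ g v) → sumFin k f < sumFin k g
sumFin-< {k} {f} {g} y gain rest = begin
  1 + sumFin k f                      ≡⟨ cong (_+ sumFin k f) (count-≟ y) ⟨
  count (_≟ y) + sumFin k f           ≡⟨ sumFin-+ k _ _ ⟨
  sumFin k (λ v → bit (v ≟ y) + f v)  ≤⟨ sumFin-mono k pointwise ⟩
  sumFin k g                          ∎
  where
  open ≤-Reasoning
  pointwise : ∀ v → bit (v ≟ y) + f v ≤ g v
  pointwise v with v ≟ y
  ... | yes refl = gain
  ... | no v≢y   = rest v v≢y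

-- Incidence, degree and multiplicity.

module Incidence {n m : ℕ} (G : MultiGraph n m) where
  open MultiGraph G

  Inc : Fin n → Fin m → Set
  Inc v e = end₁ e ≡ v ⊎ end₂ e ≡ v

  inc? : ∀ v e → Dec (Inc v e)
  inc? v e = (end₁ e ≟ v) ⊎-dec (end₂ e ≟ v)

  other : Fin n → Fin m → Fin n
  other v e with end₁ e ≟ v
  ... | yes _ = end₂ e
  ... | no _  = end₁ e

  inc-other : ∀ v e → Inc (other v e) e
  inc-other v e with end₁ e ≟ v
  ... | yes _ = inj₂ refl
  ... | no _  = inj₁ refl

  other≢ : ∀ v e → other v e ≢ v
  other≢ v e with end₁ e ≟ v
  ... | yes refl = λ eq → loopless e (sym eq)
  ... | no neq   = neq

  inc-cases : ∀ {v e u} → Inc v e → Inc u e → u ≡ v ⊎ u ≡ other v e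
  inc-cases {v} {e} iv iu with end₁ e ≟ v
  inc-cases iv (inj₁ refl)        | yes refl = inj₁ refl
  inc-cases iv (inj₂ refl)        | yes refl = inj₂ refl
  inc-cases (inj₁ eq) iu          | no neq   = contradiction eq neq
  inc-cases (inj₂ _) (inj₁ refl)  | no _     = inj₂ refl
  inc-cases (inj₂ refl) (inj₂ eq) | no _     = inj₁ (sym eq)

  other-unique : ∀ {v e u} → Inc v e → Inc u e → u ≢ v → u ≡ other v e
  other-unique iv iu u≢v with inc-cases iv iu
  ... | inj₁ u≡v = contradiction u≡v u≢v
  ... | inj₂ eq  = eq

  joins-intro : ∀ {e x y} → (end₁ e ≡ x × end₂ e ≡ y) ⊎ (end₁ e ≡ y × end₂ e ≡ x) →
    T (joins G e x y)
  joins-intro = from T-∨ ∘ Sum.map both both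
    where
    open Equivalence using (from)
    both : ∀ {a b c d : Fin n} → a ≡ b × c ≡ d → T (⌊ a ≟ b ⌋ ∧ ⌊ c ≟ d ⌋)
    both {a} {b} {c} {d} (p , q) =
      from (T-∧ {⌊ a ≟ b ⌋}) (fromWitness {a? = a ≟ b} p , fromWitness {a? = c ≟ d} q)

  ends-other : ∀ {v e} → Inc v e →
    (end₁ e ≡ v × end₂ e ≡ other v e) ⊎ (end₁ e ≡ other v e × end₂ e ≡ v)
  ends-other {v} {e} iv with end₁ e ≟ v
  ends-other iv       | yes p = inj₁ (p , refl)
  ends-other (inj₁ p) | no q  = contradiction p q
  ends-other (inj₂ p) | no _  = inj₂ (refl , p)

  joins-other : ∀ {v e} → Inc v e → T (joins G e v (other v e)) × T (joins G e (other v e) v)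
  joins-other iv = joins-intro (ends-other iv) , joins-intro (Sum.swap (ends-other iv))

  bound : Fin n → ℕ
  bound v = deg G v + maxMult G v

  -- Double counting: each edge at `v` is charged to its other end, and the edges charged to `y` are
  -- among those joining `v` and `y`.
  incidence-≤-deg : ∀ v → count (inc? v) ≤ deg G v
  incidence-≤-deg v = begin
    count (inc? v)                                 ≤⟨ sumFin-mono m split ⟩
    sumFin m (λ e → sumFin n (λ y → bit (at? e y)))  ≡⟨ sumFin-swap m n _ ⟩
    sumFin n (λ y → sumFin m (λ e → bit (at? e y)))  ≤⟨ sumFin-mono n regroup ⟩
    deg G v                                        ∎
    where
    open ≤-Reasoning
    at? : ∀ e y → Dec (Inc v e × y ≡ other v e)
    at? e y = inc? v e ×-dec (y ≟ other v e)
    split : ∀ e → bit (inc? v e) ≤ sumFin n (λ y → bit (at? e y))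
    split e = ≤-trans (bit-mono (inc? v e) (at? e (other v e)) (_, refl))
                      (≤-sumFin (bit ∘ at? e) (other v e))
    regroup : ∀ y → sumFin m (λ e → bit (at? e y)) ≤ offDiag G v (mult G v) y
    regroup y with v ≟ y
    ... | yes refl = ≤-reflexive (count-none (λ e → at? e v) (λ e (_ , eq) → other≢ v e (sym eq)))
    ... | no _     = count-mono (λ e → at? e y) (λ e → T? (joins G e v y))
                       (λ { e (iv , refl) → proj₁ (joins-other iv) })

  mult-≤-maxMult : ∀ {x z} → z ≢ x → mult G z x ≤ maxMult G z
  mult-≤-maxMult {x} {z} z≢x = ≤-trans at-x (≤-maxFin (offDiag G z (mult G z)) x)
    where
    at-x : mult G z x ≤ offDiag G z (mult G z) x
    at-x with z ≟ x
    ... | yes eq = contradiction eq z≢x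
    ... | no _   = ≤-refl

-- Partial colourings, their value and elementary recolourings.

module PartialColouring {n m : ℕ} (G : MultiGraph n m) where
  open MultiGraph G
  open Incidence G

  -- The value 0 marks an uncoloured edge.
  Colouring : Set
  Colouring = Fin m → ℕ

  ProperPartial : Colouring → Set
  ProperPartial φ = ∀ {v e g} → Inc v e → Inc v g → φ e ≡ φ g → φ e ≢ 0 → e ≡ g

  Has : Colouring → Fin n → ℕ → Set
  Has φ v γ = ∃ λ e → Inc v e × φ e ≡ γ

  has? : ∀ φ v γ → Dec (Has φ v γ)
  has? φ v γ = any? (λ e → inc? v e ×-dec (φ e ℕₚ.≟ γ))

  -- The bound is included because only colours up to `bound v` count in `value`; bringing a missing
  -- colour to `v` is then a real gain.
  Missing : Colouring → Fin n → ℕ → Set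
  Missing φ v γ = γ ≢ 0 × γ ≤ bound v × ¬ Has φ v γ

  hasSmall? : ∀ φ v (i : Fin (bound v)) → Dec (Has φ v (suc (toℕ i)))
  hasSmall? φ v i = has? φ v (suc (toℕ i))

  smallColours : Colouring → Fin n → ℕ
  smallColours φ v = count (hasSmall? φ v)

  value : Colouring → ℕ
  value φ = sumFin n (smallColours φ)

  Improvable : ℕ → Set
  Improvable N = ∃ λ ψ → ProperPartial ψ × N < value ψ

  module _ {φ ψ : Colouring} {v : Fin n} where

    smallColours-mono : (∀ γ → γ ≢ 0 → γ ≤ bound v → Has φ v γ → Has ψ v γ) →
      smallColours φ v ≤ smallColours ψ v
    smallColours-mono keep = count-mono (hasSmall? φ v) (hasSmall? ψ v) (λ i → keep (suc (toℕ i)) (λ ()) (toℕ<n i))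

    private
      index : ∀ {γ} → γ ≢ 0 → γ ≤ bound v → ∃ λ (i : Fin (bound v)) → suc (toℕ i) ≡ γ
      index {zero}  γ≢0 _ = contradiction refl γ≢0
      index {suc γ} _   γ< = fromℕ< γ< , cong suc (toℕ-fromℕ< γ<)

    smallColours-gain : (∀ γ → γ ≢ 0 → Has φ v γ → Has ψ v γ) →
      ∀ {δ} → Missing φ v δ → Has ψ v δ → suc (smallColours φ v) ≤ smallColours ψ v
    smallColours-gain keep (δ≢0 , δ≤ , ¬φδ) ψδ with index δ≢0 δ≤
    ... | i , refl = count-< (hasSmall? φ v) (hasSmall? ψ v) (λ j → keep (suc (toℕ j)) (λ ())) i ¬φδ ψδ

    smallColours-loss : ∀ {δ} → δ ≢ 0 → (∀ γ → γ ≢ 0 → γ ≢ δ → Has φ v γ → Has ψ v γ) →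
      smallColours φ v ≤ suc (smallColours ψ v)
    smallColours-loss {δ} δ≢0 keep with δ ≤? bound v
    ... | no δ≰ = ≤-trans
      (smallColours-mono (λ γ γ≢0 γ≤ → keep γ γ≢0 (λ { refl → δ≰ γ≤ }))) (n≤1+n _)
    ... | yes δ≤ with index δ≢0 δ≤
    ... | i , refl = count-≤-suc (hasSmall? φ v) (hasSmall? ψ v) i
      (λ j j≢i → keep (suc (toℕ j)) (λ ()) (j≢i ∘ Finₚ.toℕ-injective ∘ suc-injective))

  infixl 5 _[_≔_]
  _[_≔_] : Colouring → Fin m → ℕ → Colouring
  φ [ e ≔ γ ] = updateAt φ e (const γ)

  module _ (φ : Colouring) (e : Fin m) (γ : ℕ) where

    update-at : (φ [ e ≔ γ ]) e ≡ γ
    update-at = updateAt-updates e φ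

    update-off : ∀ {g} → g ≢ e → (φ [ e ≔ γ ]) g ≡ φ g
    update-off {g} = updateAt-minimal g e φ

    has-update-at : ∀ {v} → Inc v e → Has (φ [ e ≔ γ ]) v γ
    has-update-at iv = e , iv , update-at

    has-update-off : ∀ {v δ} → φ e ≢ δ → Has φ v δ → Has (φ [ e ≔ γ ]) v δ
    has-update-off φe≢δ (g , ig , eq) =
      g , ig , trans (update-off (λ { refl → φe≢δ eq })) eq

    -- Freshness is demanded only for `γ ≢ 0`, so that erasing a colour is covered as well.
    properPartial-update : ProperPartial φ → (γ ≢ 0 → ∀ {u} → Inc u e → ¬ Has φ u γ) →
      ProperPartial (φ [ e ≔ γ ])
    properPartial-update proper fresh {v} {g} {h} ig ih eq ≢0 with g ≟ e | h ≟ e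
    ... | yes refl | yes refl = refl
    ... | yes refl | no h≢ = contradiction
      (h , ih , trans (sym (update-off h≢)) (trans (sym eq) update-at))
      (fresh (subst (_≢ 0) update-at ≢0) ig)
    ... | no g≢ | yes refl = contradiction
      (g , ig , trans (sym (update-off g≢)) (trans eq update-at))
      (fresh (subst (_≢ 0) (trans eq update-at) ≢0) ih)
    ... | no g≢ | no h≢ = proper ig ih
      (trans (sym (update-off g≢)) (trans eq (update-off h≢)))
      (subst (_≢ 0) (update-off g≢) ≢0)

  -- The erased colour exceeds the bound at both ends, so it was counted at neither.
  erase-large : ∀ {φ e} → ProperPartial φ → (∀ {u} → Inc u e → bound u < φ e) →
    ProperPartial (φ [ e ≔ 0 ]) × value φ ≤ value (φ [ e ≔ 0 ])
  erase-large {φ} {e} proper large =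
    properPartial-update φ e 0 proper (λ 0≢0 → contradiction refl 0≢0) ,
    sumFin-mono n (λ v → smallColours-mono (λ γ _ γ≤ (g , ig , eq) →
      g , ig , trans (update-off φ e 0
        (λ { refl → <⇒≱ (large ig) (subst (_≤ bound v) (sym eq) γ≤) })) eq))

  IsEdge : Fin m → Fin n → Fin n → Set
  IsEdge e p q = Inc p e × Inc q e × p ≢ q

  isEdge-sym : ∀ {e p q} → IsEdge e p q → IsEdge e q p
  isEdge-sym (ip , iq , p≢q) = iq , ip , p≢q ∘ sym

  isEdge-other : ∀ {e x} → Inc x e → IsEdge e x (other x e)
  isEdge-other {e} {x} ix = ix , inc-other x e , ≢-sym (other≢ x e)

  ends : ∀ {e p q u} → IsEdge e p q → Inc u e → u ≡ p ⊎ u ≡ q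
  ends {e} {p} {q} {u} (ip , iq , p≢q) iu with u ≟ p
  ... | yes u≡p = inj₁ u≡p
  ... | no u≢p  = inj₂ (trans (other-unique ip iu u≢p) (sym (other-unique ip iq (≢-sym p≢q))))

  -- The gain at `y` alone suffices: `γ` may lie above the bound at `x`, and nothing is lost since
  -- `e` was uncoloured.
  colour-edge : ∀ {φ e x y γ} → ProperPartial φ → φ e ≡ 0 → IsEdge e x y →
    ¬ Has φ x γ → Missing φ y γ → Improvable (value φ)
  colour-edge {φ} {e} {x} {y} {γ} proper φe≡0 xy ¬xγ yγ@(γ≢0 , _ , ¬yγ) =
    φ [ e ≔ γ ] ,
    properPartial-update φ e γ proper (λ _ iu hu → case (ends xy iu) hu) ,
    sumFin-< y (smallColours-gain (λ δ δ≢0 → keep δ≢0) yγ (has-update-at φ e γ (proj₁ (proj₂ xy))))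
               (λ v _ → smallColours-mono (λ δ δ≢0 _ → keep δ≢0))
    where
    case : ∀ {u} → u ≡ x ⊎ u ≡ y → ¬ Has φ u γ
    case (inj₁ refl) = ¬xγ
    case (inj₂ refl) = ¬yγ
    keep : ∀ {δ v} → δ ≢ 0 → Has φ v δ → Has (φ [ e ≔ γ ]) v δ
    keep δ≢0 = has-update-off φ e γ (λ eq → δ≢0 (trans (sym eq) φe≡0))

  module Shift {φ e x y γ e′} (proper : ProperPartial φ) (φe≡0 : φ e ≡ 0) (xy : IsEdge e x y)
               (yγ : Missing φ y γ) (ix : Inc x e′) (φe′≡γ : φ e′ ≡ γ) where

    shift : Colouring
    shift = φ [ e′ ≔ 0 ] [ e ≔ γ ]

    private
      γ≢0 : γ ≢ 0
      γ≢0 = proj₁ yγ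
      ¬yγ : ¬ Has φ y γ
      ¬yγ = proj₂ (proj₂ yγ)
      e≢e′ : e ≢ e′
      e≢e′ refl = γ≢0 (trans (sym φe′≡γ) φe≡0)

    shift-off : ∀ {g} → g ≢ e → g ≢ e′ → shift g ≡ φ g
    shift-off g≢e g≢e′ =
      trans (update-off (φ [ e′ ≔ 0 ]) e γ g≢e) (update-off φ e′ 0 g≢e′)

    shift-new : shift e ≡ γ
    shift-new = update-at (φ [ e′ ≔ 0 ]) e γ

    shift-old : shift e′ ≡ 0
    shift-old = trans (update-off (φ [ e′ ≔ 0 ]) e γ (≢-sym e≢e′)) (update-at φ e′ 0)

    shift-proper : ProperPartial shift
    shift-proper = properPartial-update (φ [ e′ ≔ 0 ]) e γ
      (properPartial-update φ e′ 0 proper (λ 0≢0 → contradiction refl 0≢0))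
      (λ _ iu → fresh (ends xy iu))
      where
      erased : ∀ {u} → Has (φ [ e′ ≔ 0 ]) u γ → ∃ λ g → Inc u g × φ g ≡ γ × g ≢ e′
      erased (g , ig , eq) = g , ig , trans (sym (update-off φ e′ 0 g≢e′)) eq , g≢e′
        where
        g≢e′ : g ≢ e′
        g≢e′ refl = γ≢0 (trans (sym eq) (update-at φ e′ 0))
      fresh : ∀ {u} → u ≡ x ⊎ u ≡ y → ¬ Has (φ [ e′ ≔ 0 ]) u γ
      fresh (inj₁ refl) h with erased h
      ... | g , ig , eq , g≢e′ =
        g≢e′ (proper ig ix (trans eq (sym φe′≡γ)) (λ eq₀ → γ≢0 (trans (sym eq) eq₀)))
      fresh (inj₂ refl) h with erased h
      ... | g , ig , eq , _ = ¬yγ (g , ig , eq)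

    -- At `x` the colour `γ` merely passes from `e′` to `e`; `y` gains it, and only the other end of
    -- `e′` can lose it.
    shift-value : value φ ≤ value shift
    shift-value = sumFin-exchange-≤ y (other x e′)
      (smallColours-gain keep-y yγ (e , proj₁ (proj₂ xy) , shift-new))
      (smallColours-loss γ≢0 (λ δ → keep))
      rest
      where
      keep-edge : ∀ {g δ} → δ ≢ 0 → φ g ≡ δ → g ≢ e′ → shift g ≡ δ
      keep-edge δ≢0 eq g≢e′ = trans (shift-off (λ { refl → δ≢0 (trans (sym eq) φe≡0) }) g≢e′) eq
      keep : ∀ {v δ} → δ ≢ 0 → δ ≢ γ → Has φ v δ → Has shift v δ
      keep δ≢0 δ≢γ (g , ig , eq) =
        g , ig , keep-edge δ≢0 eq (λ { refl → δ≢γ (trans (sym eq) φe′≡γ) })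
      keep-y : ∀ δ → δ ≢ 0 → Has φ y δ → Has shift y δ
      keep-y δ δ≢0 h = keep δ≢0 (λ { refl → ¬yγ h }) h
      rest : ∀ v → v ≢ y → v ≢ other x e′ → smallColours φ v ≤ smallColours shift v
      rest v v≢y v≢z = smallColours-mono keep-v
        where
        keep-v : ∀ δ → δ ≢ 0 → δ ≤ bound v → Has φ v δ → Has shift v δ
        keep-v δ δ≢0 _ (g , ig , eq) with g ≟ e′
        ... | no g≢e′  = g , ig , keep-edge δ≢0 eq g≢e′
        ... | yes refl with inc-cases ix ig
        ... | inj₁ refl = e , proj₁ xy , trans shift-new (trans (sym φe′≡γ) eq)
        ... | inj₂ v≡z  = contradiction v≡z v≢z

-- Exchanging two colours on a closed vertex set.

transpose : ℕ → ℕ → ℕ → ℕ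
transpose α β γ with γ ℕₚ.≟ α | γ ℕₚ.≟ β
... | yes _ | _     = β
... | no _  | yes _ = α
... | no _  | no _  = γ

module _ (α β : ℕ) where

  transpose-α : transpose α β α ≡ β
  transpose-α with α ℕₚ.≟ α
  ... | yes _ = refl
  ... | no ≢  = contradiction refl ≢

  transpose-β : transpose α β β ≡ α
  transpose-β with β ℕₚ.≟ α | β ℕₚ.≟ β
  ... | yes eq | _     = eq
  ... | no _   | yes _ = refl
  ... | no _   | no ≢  = contradiction refl ≢

  transpose-other : ∀ {γ} → γ ≢ α → γ ≢ β → transpose α β γ ≡ γ
  transpose-other {γ} γ≢α γ≢β with γ ℕₚ.≟ α | γ ℕₚ.≟ β
  ... | yes eq | _      = contradiction eq γ≢α
  ... | no _   | yes eq = contradiction eq γ≢β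
  ... | no _   | no _   = refl

  transpose-involutive : ∀ γ → transpose α β (transpose α β γ) ≡ γ
  transpose-involutive γ with γ ℕₚ.≟ α | γ ℕₚ.≟ β
  ... | yes refl | _        = transpose-β
  ... | no _     | yes refl = transpose-α
  ... | no γ≢α   | no γ≢β   = transpose-other γ≢α γ≢β

  transpose-injective : ∀ {γ δ} → transpose α β γ ≡ transpose α β δ → γ ≡ δ
  transpose-injective {γ} {δ} eq =
    trans (sym (transpose-involutive γ)) (trans (cong (transpose α β) eq) (transpose-involutive δ))

module Kempe {n m : ℕ} (G : MultiGraph n m) where
  open MultiGraph G
  open Incidence G
  open PartialColouring G

  -- In other words, `S` is a union of components of the subgraph formed by the edges coloured `α`
  -- or `β`.
  Closed : Colouring → ℕ → ℕ → (Fin n → Set) → Set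
  Closed φ α β S = ∀ {u v g} → φ g ≡ α ⊎ φ g ≡ β → Inc u g → Inc v g → S u → S v

  module Swap (φ : Colouring) {α β : ℕ} (α≢0 : α ≢ 0) (β≢0 : β ≢ 0)
              {S : Fin n → Set} (S? : ∀ v → Dec (S v)) (closed : Closed φ α β S) where

    -- Testing one end suffices: an edge with just one end in `S` is coloured neither `α` nor `β`,
    -- so the transposition fixes its colour.
    swap : Colouring
    swap g with S? (end₁ g)
    ... | yes _ = transpose α β (φ g)
    ... | no _  = φ g

    private
      transpose-fixed : ∀ {γ} → ¬ (γ ≡ α ⊎ γ ≡ β) → transpose α β γ ≡ γ
      transpose-fixed ≢ = transpose-other α β (≢ ∘ inj₁) (≢ ∘ inj₂)

      mixed : ∀ {u v g} → Inc u g → Inc v g → S u → ¬ S v → transpose α β (φ g) ≡ φ g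
      mixed iu iv su ¬sv = transpose-fixed (λ eq → ¬sv (closed eq iu iv su))

    swap-in : ∀ {v g} → Inc v g → S v → swap g ≡ transpose α β (φ g)
    swap-in {v} {g} iv sv with S? (end₁ g)
    ... | yes _ = refl
    ... | no ¬s = sym (mixed iv (inj₁ refl) sv ¬s)

    swap-out : ∀ {v g} → Inc v g → ¬ S v → swap g ≡ φ g
    swap-out {v} {g} iv ¬sv with S? (end₁ g)
    ... | yes s = mixed (inj₁ refl) iv s ¬sv
    ... | no _  = refl

    swap-0 : ∀ {g} → φ g ≡ 0 → swap g ≡ 0
    swap-0 {g} eq with S? (end₁ g)
    ... | no _  = eq
    ... | yes _ = trans (cong (transpose α β) eq) (transpose-other α β (≢-sym α≢0) (≢-sym β≢0))

    swap-proper : ProperPartial φ → ProperPartial swap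
    swap-proper proper {v} {g} {h} ig ih eq ≢0 with S? v
    ... | yes sv = proper ig ih
      (transpose-injective α β (trans (sym (swap-in ig sv)) (trans eq (swap-in ih sv))))
      (≢0 ∘ swap-0)
    ... | no ¬sv = proper ig ih (trans (sym (swap-out ig ¬sv)) (trans eq (swap-out ih ¬sv)))
      (≢0 ∘ swap-0)

    has-swap-in : ∀ {v γ} → S v → Has φ v γ → Has swap v (transpose α β γ)
    has-swap-in sv (g , ig , eq) = g , ig , trans (swap-in ig sv) (cong (transpose α β) eq)

    has-swap-in⁻ : ∀ {v γ} → S v → Has swap v γ → Has φ v (transpose α β γ)
    has-swap-in⁻ sv (g , ig , eq) = g , ig ,
      trans (sym (transpose-involutive α β (φ g))) (cong (transpose α β) (trans (sym (swap-in ig sv)) eq))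

    has-swap-out : ∀ {v γ} → ¬ S v → Has φ v γ → Has swap v γ
    has-swap-out ¬sv (g , ig , eq) = g , ig , trans (swap-out ig ¬sv) eq

    has-swap-out⁻ : ∀ {v γ} → ¬ S v → Has swap v γ → Has φ v γ
    has-swap-out⁻ ¬sv (g , ig , eq) = g , ig , trans (sym (swap-out ig ¬sv)) eq

  -- After the swap β is free at both p and q. The ends p and q each gain a colour
  -- that counts, and only z can lose one.
  kempe-change : ∀ {φ e p q α β} {S : Fin n → Set} → ProperPartial φ → φ e ≡ 0 → IsEdge e p q →
    Missing φ p α → Missing φ q β → (∀ v → Dec (S v)) → Closed φ α β S → S p → ¬ S q →
    ∀ z → (∀ v → S v → v ≢ p → v ≢ z → Has φ v α × Has φ v β) → Improvable (value φ)
  kempe-change {φ} {e} {p} {q} {α} {β} {S} proper φe≡0 pq@(ip , iq , p≢q)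
    pα@(α≢0 , α≤ , ¬pα) qβ@(β≢0 , β≤ , ¬qβ) S? closed sp ¬sq z both
    with has? φ p β
  -- If `p` lacks `β`, the edge can be coloured at once. Otherwise the swap turns the `β`-edge at
  -- `p` into an `α`-edge, which is the gain at `p`.
  ... | no ¬pβ  = colour-edge proper φe≡0 pq ¬pβ qβ
  ... | yes hpβ = ψ , ψ-proper ,
    sumFin-exchange-< p q z p≢q
      (smallColours-gain keep-p pα (lift α≢0 (subst (Has swap p) (transpose-β α β) (has-swap-in sp hpβ))))
      (smallColours-gain (λ δ δ≢0 h → lift δ≢0 (has-swap-out ¬sq h)) qβ (has-update-at swap e β iq))
      (λ v _ _ → loss v) rest
    where
    open Swap φ α≢0 β≢0 S? closed
    ψ : Colouring
    ψ = swap [ e ≔ β ]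
    ψ-proper : ProperPartial ψ
    ψ-proper = properPartial-update swap e β (swap-proper proper) (λ _ iu → fresh (ends pq iu))
      where
      fresh : ∀ {u} → u ≡ p ⊎ u ≡ q → ¬ Has swap u β
      fresh (inj₁ refl) h = ¬pα (subst (Has φ p) (transpose-β α β) (has-swap-in⁻ sp h))
      fresh (inj₂ refl) h = ¬qβ (has-swap-out⁻ ¬sq h)
    lift : ∀ {v δ} → δ ≢ 0 → Has swap v δ → Has ψ v δ
    lift δ≢0 = has-update-off swap e β (λ eq → δ≢0 (trans (sym eq) (swap-0 φe≡0)))
    keep : ∀ {v δ} → δ ≢ 0 → δ ≢ α → δ ≢ β → S v → Has φ v δ → Has ψ v δ
    keep {v} δ≢0 δ≢α δ≢β sv h =
      lift δ≢0 (subst (Has swap v) (transpose-other α β δ≢α δ≢β) (has-swap-in sv h))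
    keep-p : ∀ δ → δ ≢ 0 → Has φ p δ → Has ψ p δ
    keep-p δ δ≢0 h with δ ℕₚ.≟ α | δ ℕₚ.≟ β
    ... | yes refl | _        = contradiction h ¬pα
    -- The swap takes `β` away from `p`, and the newly coloured `e` brings it back.
    ... | no _     | yes refl = has-update-at swap e β ip
    ... | no δ≢α   | no δ≢β   = keep δ≢0 δ≢α δ≢β sp h
    gain-β : ∀ {v} → S v → Has φ v α → Has ψ v β
    gain-β {v} sv h = lift β≢0 (subst (Has swap v) (transpose-α α β) (has-swap-in sv h))
    gain-α : ∀ {v} → S v → Has φ v β → Has ψ v α
    gain-α {v} sv h = lift α≢0 (subst (Has swap v) (transpose-β α β) (has-swap-in sv h))
    -- Inside `S`, a vertex with `α` receives `β` from the swap and can lose only `α`; a vertex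
    -- without `α` can lose only `β`.
    loss : ∀ v → smallColours φ v ≤ suc (smallColours ψ v)
    loss v with S? v
    ... | no ¬sv = smallColours-loss α≢0 (λ δ δ≢0 _ h → lift δ≢0 (has-swap-out ¬sv h))
    ... | yes sv with has? φ v α
    ... | yes hα = smallColours-loss α≢0 keep-v
      where
      keep-v : ∀ δ → δ ≢ 0 → δ ≢ α → Has φ v δ → Has ψ v δ
      keep-v δ δ≢0 δ≢α h with δ ℕₚ.≟ β
      ... | yes refl = gain-β sv hα
      ... | no δ≢β   = keep δ≢0 δ≢α δ≢β sv h
    ... | no ¬hα = smallColours-loss β≢0
      (λ δ δ≢0 δ≢β h → keep δ≢0 (λ { refl → ¬hα h }) δ≢β sv h)
    rest : ∀ v → v ≢ p → v ≢ q → v ≢ z → smallColours φ v ≤ smallColours ψ v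
    rest v v≢p v≢q v≢z with S? v
    ... | no ¬sv = smallColours-mono (λ δ δ≢0 _ h → lift δ≢0 (has-swap-out ¬sv h))
    ... | yes sv = smallColours-mono keep-v
      where
      keep-v : ∀ δ → δ ≢ 0 → δ ≤ bound v → Has φ v δ → Has ψ v δ
      keep-v δ δ≢0 _ h with δ ℕₚ.≟ α | δ ℕₚ.≟ β
      ... | yes refl | _        = gain-α sv (proj₂ (both v sv v≢p v≢z))
      ... | no _     | yes refl = gain-β sv (proj₁ (both v sv v≢p v≢z))
      ... | no δ≢α   | no δ≢β   = keep δ≢0 δ≢α δ≢β sv h

-- Bounded search and alternating orbits of two involutions.

first : {P Q : ℕ → Set} → (∀ k → P k ⊎ Q k) → ∀ b →
  (∀ k → k < b → P k) ⊎ ∃ λ K → Q K × (∀ k → k < K → P k)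
first dec zero = inj₁ (λ _ ())
first dec (suc b) with first dec b
... | inj₂ found = inj₂ found
... | inj₁ all with dec b
...   | inj₂ q = inj₂ (b , q , all)
...   | inj₁ p = inj₁ (λ k k<1+b → Sum.[ all k , (λ { refl → p }) ] (m≤n⇒m<n∨m≡n (≤-pred k<1+b)))

-- The orbit of s under two involutions a and b, where b fixes s, is a path:
-- apply a, b, a, … in turn until the point no longer moves.
module Chain {n : ℕ} (a b : Fin n → Fin n) (a-involutive : ∀ v → a (a v) ≡ v)
             (b-involutive : ∀ v → b (b v) ≡ v) (s : Fin n) (bs≡s : b s ≡ s) where

  private
    turn : ℕ → Fin n → Fin n
    turn zero          = a
    turn (suc zero)    = b
    turn (suc (suc k)) = turn k

    turn-involutive : ∀ k v → turn k (turn k v) ≡ v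
    turn-involutive zero          = a-involutive
    turn-involutive (suc zero)    = b-involutive
    turn-involutive (suc (suc k)) = turn-involutive k

    turn-cases : ∀ k → (turn k ≡ a × turn (suc k) ≡ b) ⊎ (turn k ≡ b × turn (suc k) ≡ a)
    turn-cases zero          = inj₁ (refl , refl)
    turn-cases (suc zero)    = inj₂ (refl , refl)
    turn-cases (suc (suc k)) = turn-cases k

    walk : ℕ → Fin n
    walk zero    = s
    walk (suc k) = turn k (walk k)

    walk-back : ∀ k → turn k (walk (suc k)) ≡ walk k
    walk-back k = turn-involutive k (walk k)

    Stalled : ℕ → Set
    Stalled k = walk (suc k) ≡ walk k

    infixl 6 _+2*_
    -- Recursion on the second argument adds two successors at a time, matching the period of
    -- `turn`.
    _+2*_ : ℕ → ℕ → ℕ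
    i +2* zero  = i
    i +2* suc d = suc (suc (i +2* d))

    suc-+2* : ∀ i d → suc i +2* d ≡ suc (i +2* d)
    suc-+2* i zero    = refl
    suc-+2* i (suc d) = cong (suc ∘ suc) (suc-+2* i d)

    turn-+2* : ∀ i d → turn (i +2* d) ≡ turn i
    turn-+2* i zero    = refl
    turn-+2* i (suc d) = turn-+2* i d

    -- The same involution takes the earlier visit one step forward and the later one a step back.
    -- The two close in until consecutive points agree.
    odd-collision : ∀ d i → walk i ≡ walk (suc (i +2* d)) → ∃ λ k → k < suc (i +2* d) × Stalled k
    odd-collision zero    i eq = i , ≤-refl , sym eq
    odd-collision (suc d) i eq with odd-collision d (suc i) (begin
        turn i (walk i)                              ≡⟨ cong (turn i) eq ⟩
        turn i (walk (suc (i +2* suc d)))            ≡⟨ cong (λ t → t (walk (suc (i +2* suc d)))) (turn-+2* i (suc d)) ⟨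
        turn (i +2* suc d) (walk (suc (i +2* suc d)))  ≡⟨ walk-back (i +2* suc d) ⟩
        walk (i +2* suc d)                           ≡⟨ cong (walk ∘ suc) (suc-+2* i d) ⟨
        walk (suc (suc i +2* d))                     ∎)
      where open ≡-Reasoning
    ... | k , k< , stalled =
      k , ≤-trans k< (≤-trans (≤-reflexive (cong suc (suc-+2* i d))) (n≤1+n _)) , stalled

    -- The same involution leads into both visits, so both indices can be lowered until the earlier
    -- is 0. There `b` fixes `s`, and undoing the last `b`-step leaves an odd collision.
    even-collision : ∀ d i → walk i ≡ walk (i +2* suc d) → ∃ λ k → k < i +2* suc d × Stalled k
    even-collision d zero eq with odd-collision d 0 (begin
        s                                              ≡⟨ bs≡s ⟨
        b s                                            ≡⟨ cong b eq ⟩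
        b (walk (0 +2* suc d))                         ≡⟨ cong (λ t → t (walk (0 +2* suc d))) (turn-+2* 1 d) ⟨
        turn (1 +2* d) (walk (0 +2* suc d))            ≡⟨ cong (λ k → turn k (walk (0 +2* suc d))) (suc-+2* 0 d) ⟩
        turn (suc (0 +2* d)) (walk (0 +2* suc d))      ≡⟨ walk-back (suc (0 +2* d)) ⟩
        walk (suc (0 +2* d))                           ∎)
      where open ≡-Reasoning
    ... | k , k< , stalled = k , ≤-trans k< (n≤1+n _) , stalled
    even-collision d (suc i) eq with even-collision d i (begin
        walk i                                         ≡⟨ walk-back i ⟨
        turn i (walk (suc i))                          ≡⟨ cong (turn i) eq ⟩
        turn i (walk (suc i +2* suc d))                ≡⟨ cong (turn i ∘ walk) (suc-+2* i (suc d)) ⟩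
        turn i (walk (suc (i +2* suc d)))              ≡⟨ cong (λ t → t (walk (suc (i +2* suc d)))) (turn-+2* i (suc d)) ⟨
        turn (i +2* suc d) (walk (suc (i +2* suc d)))  ≡⟨ walk-back (i +2* suc d) ⟩
        walk (i +2* suc d)                             ∎)
      where open ≡-Reasoning
    ... | k , k< , stalled =
      k , ≤-trans k< (≤-trans (n≤1+n _) (≤-reflexive (sym (suc-+2* i (suc d))))) , stalled

    offset-parity : ∀ o i →
      (∃ λ d → suc (o + i) ≡ suc (i +2* d)) ⊎ (∃ λ d → suc (o + i) ≡ i +2* suc d)
    offset-parity zero    i = inj₁ (0 , refl)
    offset-parity (suc o) i with offset-parity o i
    ... | inj₁ (d , eq) = inj₂ (d , cong suc eq)
    ... | inj₂ (d , eq) = inj₁ (suc d , cong suc eq)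

    collision : ∀ {i j} → i < j → walk i ≡ walk j → ∃ λ k → k < j × Stalled k
    collision {i} {j} i<j eq with offset-parity (j ∸ suc i) i | m∸n+n≡m i<j
    ... | parity | j≡ with subst (λ t → (∃ λ d → t ≡ suc (i +2* d)) ⊎ (∃ λ d → t ≡ i +2* suc d))
                             (trans (sym (+-suc _ i)) j≡) parity
    ... | inj₁ (d , refl) = odd-collision d i eq
    ... | inj₂ (d , refl) = even-collision d i eq

    abstract
      stalls : ∃ λ K → Stalled K × (∀ k → k < K → ¬ Stalled k)
      stalls with first (λ k → Sum.swap (Dec.toSum (walk (suc k) ≟ walk k))) (suc n)
      ... | inj₂ found = found
      ... | inj₁ moving with Finₚ.pigeonhole (n<1+n n) (walk ∘ toℕ)
      ... | i , j , i<j , eq with collision i<j eq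
      ... | k , k<j , stalled = contradiction stalled (moving k (<-trans k<j (toℕ<n j)))

    K : ℕ
    K = proj₁ stalls

    moving : ∀ k → k < K → ¬ Stalled k
    moving = proj₂ (proj₂ stalls)

  abstract
    Orbit : Fin n → Set
    Orbit v = ∃ λ (i : Fin (suc K)) → walk (toℕ i) ≡ v

    orbit? : ∀ v → Dec (Orbit v)
    orbit? v = any? (λ i → walk (toℕ i) ≟ v)

    last : Fin n
    last = walk K

    private
      walk-orbit : ∀ {k} → k ≤ K → Orbit (walk k)
      walk-orbit k≤K = fromℕ< (s≤s k≤K) , cong walk (toℕ-fromℕ< (s≤s k≤K))

      turn-orbit : ∀ k → k ≤ K → Orbit (turn k (walk k))
      turn-orbit k k≤K with m≤n⇒m<n∨m≡n k≤K
      ... | inj₁ k<K  = walk-orbit k<K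
      ... | inj₂ refl = subst Orbit (sym (proj₁ (proj₂ stalls))) (walk-orbit ≤-refl)

      turn-back-orbit : ∀ k → k ≤ K → Orbit (turn (suc k) (walk k))
      turn-back-orbit zero    _  = subst Orbit (sym bs≡s) (walk-orbit z≤n)
      turn-back-orbit (suc k) k< = subst Orbit (sym (walk-back k)) (walk-orbit (<⇒≤ k<))

      orbit-elim : (P : Fin n → Set) → (∀ k → k ≤ K → P (walk k)) → ∀ {v} → Orbit v → P v
      orbit-elim P f (i , refl) = f (toℕ i) (≤-pred (toℕ<n i))

    orbit-start : Orbit s
    orbit-start = walk-orbit z≤n

    -- At each point one involution steps forward along the path and the other back, staying put at
    -- the ends; `turn-cases` tells which one is `a`.
    orbit-a : ∀ {v} → Orbit v → Orbit (a v)
    orbit-a = orbit-elim (Orbit ∘ a) λ k k≤K → Sum.[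
      (λ (eq , _) → subst (λ t → Orbit (t (walk k))) eq (turn-orbit k k≤K)) ,
      (λ (_ , eq) → subst (λ t → Orbit (t (walk k))) eq (turn-back-orbit k k≤K)) ]′ (turn-cases k)

    orbit-b : ∀ {v} → Orbit v → Orbit (b v)
    orbit-b = orbit-elim (Orbit ∘ b) λ k k≤K → Sum.[
      (λ (_ , eq) → subst (λ t → Orbit (t (walk k))) eq (turn-back-orbit k k≤K)) ,
      (λ (eq , _) → subst (λ t → Orbit (t (walk k))) eq (turn-orbit k k≤K)) ]′ (turn-cases k)

    -- A point after the start of the path was entered by a genuine move, and the same involution
    -- moves it back.
    orbit-isolated : ∀ {v} → Orbit v → a v ≡ v → b v ≡ v → v ≡ s
    orbit-isolated = orbit-elim (λ v → a v ≡ v → b v ≡ v → v ≡ s) isolated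
      where
      isolated : ∀ k → k ≤ K → a (walk k) ≡ walk k → b (walk k) ≡ walk k → walk k ≡ s
      isolated zero    _  _  _  = refl
      isolated (suc k) k< aw bw = contradiction (trans (sym fixed) (walk-back k)) (moving k k<)
        where
        fixed : turn k (walk (suc k)) ≡ walk (suc k)
        fixed with turn-cases k
        ... | inj₁ (eq , _) = trans (cong (λ t → t (walk (suc k))) eq) aw
        ... | inj₂ (eq , _) = trans (cong (λ t → t (walk (suc k))) eq) bw

    -- The involution that leads into an inner point and the one that leads out of it both move it,
    -- since the path stalls only at `K`.
    orbit-inner : ∀ {v} → Orbit v → v ≢ s → v ≢ last → a v ≢ v × b v ≢ v
    orbit-inner = orbit-elim (λ v → v ≢ s → v ≢ last → a v ≢ v × b v ≢ v) inner
      where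
      inner : ∀ k → k ≤ K → walk k ≢ s → walk k ≢ last → a (walk k) ≢ walk k × b (walk k) ≢ walk k
      inner zero    _   ≢s _     = contradiction refl ≢s
      inner (suc k) k<K ≢s ≢last with m≤n⇒m<n∨m≡n k<K
      ... | inj₂ 1+k≡K = contradiction (cong walk 1+k≡K) ≢last
      ... | inj₁ 1+k<K with turn-cases k
      ...   | inj₁ (eq , eq′) =
        (λ f → moving k k<K (trans (sym (trans (cong (λ t → t (walk (suc k))) eq) f)) (walk-back k))) ,
        (λ f → moving (suc k) 1+k<K (trans (cong (λ t → t (walk (suc k))) eq′) f))
      ...   | inj₂ (eq , eq′) =
        (λ f → moving (suc k) 1+k<K (trans (cong (λ t → t (walk (suc k))) eq′) f)) ,
        (λ f → moving k k<K (trans (sym (trans (cong (λ t → t (walk (suc k))) eq) f)) (walk-back k)))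

    start-moves : last ≢ s → a s ≢ s
    start-moves last≢s = moving 0 (n≢0⇒n>0 (λ K≡0 → last≢s (cong walk K≡0)))

-- Vizing fans at an uncoloured edge.

module Fan {n m : ℕ} (G : MultiGraph n m) where
  open MultiGraph G
  open Incidence G
  open PartialColouring G
  open Kempe G

  module Partner (φ : Colouring) (proper : ProperPartial φ) {γ : ℕ} (γ≢0 : γ ≢ 0) where

    abstract
      -- Properness leaves at most one edge coloured `γ` at a vertex, so this is an involution; its
      -- fixed points are the vertices lacking `γ`, where alternating paths end.
      partner : Fin n → Fin n
      partner v with has? φ v γ
      ... | yes (g , _) = other v g
      ... | no _        = v

      partner-edge : ∀ {v g} → Inc v g → φ g ≡ γ → partner v ≡ other v g
      partner-edge {v} {g} ig eq with has? φ v γ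
      ... | no ¬h               = contradiction (g , ig , eq) ¬h
      ... | yes (h , ih , eq′) =
        cong (other v) (proper ih ig (trans eq′ (sym eq)) (λ eq₀ → γ≢0 (trans (sym eq′) eq₀)))

      partner-missing : ∀ {v} → ¬ Has φ v γ → partner v ≡ v
      partner-missing {v} ¬h with has? φ v γ
      ... | no _  = refl
      ... | yes h = contradiction h ¬h

      partner-moves : ∀ {v} → partner v ≢ v → Has φ v γ
      partner-moves {v} moves with has? φ v γ
      ... | no _  = contradiction refl moves
      ... | yes h = h

      partner-involutive : ∀ v → partner (partner v) ≡ v
      partner-involutive v with has? φ v γ
      ... | no ¬h             = partner-missing ¬h
      ... | yes (g , ig , eq) = trans (partner-edge (inc-other v g) eq)
        (sym (other-unique (inc-other v g) ig (≢-sym (other≢ v g))))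

  module At {φ : Colouring} (proper : ProperPartial φ) {e₀ : Fin m} (φe₀≡0 : φ e₀ ≡ 0) where

    x : Fin n
    x = end₁ e₀

    missing? : ∀ v (i : Fin (bound v)) → Dec (¬ Has φ v (suc (toℕ i)))
    missing? v i = ¬? (hasSmall? φ v i)

    coloured? : ∀ v e → Dec (Inc v e × φ e ≢ 0)
    coloured? v e = inc? v e ×-dec ¬? (φ e ℕₚ.≟ 0)

    smallColours-≤-coloured : ∀ v → smallColours φ v ≤ count (coloured? v)
    smallColours-≤-coloured v = count-injection (hasSmall? φ v) (coloured? v)
      (λ _ → proj₁)
      (λ { i (g , ig , eq) → ig , λ eq₀ → contradiction (trans (sym eq) eq₀) λ () })
      (λ { i i′ (_ , _ , eq) (_ , _ , eq′) refl →
           Finₚ.toℕ-injective (suc-injective (trans (sym eq) eq′)) })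

    smallColours-≤-deg : ∀ v → smallColours φ v ≤ deg G v
    smallColours-≤-deg v = ≤-trans (smallColours-≤-coloured v)
      (≤-trans (count-mono (coloured? v) (inc? v) (λ _ → proj₁)) (incidence-≤-deg v))

    -- At most `deg G v` of the `bound v` colours occur at `v`, so enough are missing to reserve
    -- different ones for parallel edges.
    maxMult-≤-missing : ∀ v → maxMult G v ≤ count (missing? v)
    maxMult-≤-missing v = +-cancelˡ-≤ (smallColours φ v) _ _ (begin
      smallColours φ v + maxMult G v        ≤⟨ +-monoˡ-≤ _ (smallColours-≤-deg v) ⟩
      bound v                               ≡⟨ count-complement (hasSmall? φ v) ⟨
      smallColours φ v + count (missing? v) ∎)
      where open ≤-Reasoning

    -- The edge `e₀` contributes to the degree of `x` but brings no colour.
    missing-at-x : ∃ (Missing φ x)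
    missing-at-x with count-positive (missing? x) (+-cancelˡ-≤ (smallColours φ x) _ _ (begin
        smallColours φ x + 1                  ≡⟨ +-comm _ 1 ⟩
        suc (smallColours φ x)                ≤⟨ s≤s (smallColours-≤-coloured x) ⟩
        suc (count (coloured? x))             ≤⟨ count-< (coloured? x) (inc? x) (λ _ → proj₁) e₀
                                                   (λ (_ , ≢0) → ≢0 φe₀≡0) (inj₁ refl) ⟩
        count (inc? x)                        ≤⟨ incidence-≤-deg x ⟩
        deg G x                               ≤⟨ m≤m+n _ _ ⟩
        bound x                               ≡⟨ count-complement (hasSmall? φ x) ⟨
        smallColours φ x + count (missing? x) ∎))
      where open ≤-Reasoning
    ... | i , ¬h = suc (toℕ i) , (λ ()) , toℕ<n i , ¬h

    -- One choice serves all edges between `z` and `x`, which keeps parallel edges apart. As `z ≢ x`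
    -- is asked for only after the choice, the colours do not depend on its proof; at `x` itself a
    -- placeholder is taken.
    palette : ∀ z → Σ (Fin m → ℕ) λ c → z ≢ x →
      (∀ e → T (joins G e z x) → Missing φ z (c e)) ×
      (∀ e e′ → T (joins G e z x) → T (joins G e′ z x) → c e ≡ c e′ → e ≡ e′)
    palette z with z ≟ x
    ... | yes z≡x = const 0 , λ z≢x → contradiction z≡x z≢x
    ... | no z≢x with injection-from-count (λ e → T? (joins G e z x)) (missing? z)
                       (≤-trans (mult-≤-maxMult z≢x) (maxMult-≤-missing z))
    ... | c , c-missing , c-inj = c , λ _ → missing , c-inj
      where
      missing : ∀ e → T (joins G e z x) → Missing φ z (c e)
      missing e j with c-missing e j
      ... | i , ¬h , eq = subst (Missing φ z) (sym eq) ((λ ()) , toℕ<n i , ¬h)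

    c : Fin m → ℕ
    c e = proj₁ (palette (other x e)) e

    c-missing : ∀ {e} → Inc x e → Missing φ (other x e) (c e)
    c-missing {e} ie = proj₁ (proj₂ (palette (other x e)) (other≢ x e)) e (proj₂ (joins-other ie))

    c-injective : ∀ {e e′} → Inc x e → Inc x e′ → other x e ≡ other x e′ → c e ≡ c e′ → e ≡ e′
    c-injective {e} {e′} ie ie′ eq ceq =
      proj₂ (proj₂ (palette (other x e)) (other≢ x e)) e e′ (proj₂ (joins-other ie))
        (subst (λ z → T (joins G e′ z x)) (sym eq) (proj₂ (joins-other ie′)))
        (trans ceq (cong (λ z → proj₁ (palette z) e′) (sym eq)))

    next : Fin m → Fin m
    next e with has? φ x (c e)
    ... | yes (g , _) = g
    -- A placeholder: the fan stops at such an edge.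
    ... | no _        = e

    s : ℕ → Fin m
    s zero    = e₀
    s (suc k) = next (s k)

    inc-next : ∀ {e} → Inc x e → Inc x (next e)
    inc-next {e} ie with has? φ x (c e)
    ... | yes (_ , ig , _) = ig
    ... | no _             = ie

    inc-s : ∀ k → Inc x (s k)
    inc-s zero    = inj₁ refl
    inc-s (suc k) = inc-next (inc-s k)

    colour-next : ∀ {e} → Has φ x (c e) → φ (next e) ≡ c e
    colour-next {e} h with has? φ x (c e)
    ... | yes (_ , _ , eq) = eq
    ... | no ¬h            = contradiction h ¬h

    y : ℕ → Fin n
    y k = other x (s k)

    c≢0 : ∀ k → c (s k) ≢ 0
    c≢0 k = proj₁ (c-missing (inc-s k))

    Extends Stops : ℕ → Set
    Extends k = Has φ x (c (s k)) × (∀ i → i < k → c (s i) ≢ c (s k))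
    Stops k   = ¬ Has φ x (c (s k)) ⊎ ∃ λ i → i < k × c (s i) ≡ c (s k)

    extends-or-stops : ∀ k → Extends k ⊎ Stops k
    extends-or-stops k with has? φ x (c (s k)) | anyUpTo? (λ i → c (s i) ℕₚ.≟ c (s k)) k
    ... | no ¬h | _          = inj₂ (inj₁ ¬h)
    ... | yes _ | yes repeat = inj₂ (inj₂ repeat)
    ... | yes h | no ¬repeat = inj₁ (h , λ i i<k eq → ¬repeat (i , i<k , eq))

    module Upto {J : ℕ} (extends : ∀ k → k < J → Extends k) where

      colour-s : ∀ {k} → k < J → φ (s (suc k)) ≡ c (s k)
      colour-s {k} k<J = colour-next (proj₁ (extends k k<J))

      -- Equal fan edges have equal colours in `φ`, hence predecessors with the same reserved
      -- colour, against `Extends`. The edge `s 0` differs from the later ones by being uncoloured.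
      distinct : ∀ {i k} → i < k → k ≤ J → s i ≢ s k
      distinct {zero}  {suc k} _   k<J eq =
        c≢0 k (trans (sym (colour-s k<J)) (trans (cong φ (sym eq)) φe₀≡0))
      distinct {suc i} {suc k} i<k k<J eq = proj₂ (extends k k<J) i (≤-pred i<k)
        (trans (sym (colour-s (<-trans (≤-pred i<k) k<J))) (trans (cong φ eq) (colour-s k<J)))

      ψ : ℕ → Colouring
      ψ zero    = φ
      ψ (suc k) = ψ k [ s (suc k) ≔ 0 ] [ s k ≔ c (s k) ]

      record Shifted (k : ℕ) : Set where
        field
          proper-ψ   : ProperPartial (ψ k)
          value-ψ    : value φ ≤ value (ψ k)
          uncoloured : ψ k (s k) ≡ 0
          behind     : ∀ {l} → l < k → ψ k (s l) ≡ c (s l)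
          elsewhere  : ∀ {g} → (∀ l → l ≤ k → g ≢ s l) → ψ k g ≡ φ g

        ahead : ∀ {l} → k < l → l ≤ J → ψ k (s l) ≡ φ (s l)
        ahead k<l l≤J = elsewhere (λ r r≤k → ≢-sym (distinct (≤-<-trans r≤k k<l) l≤J))

        data Origin (g : Fin m) : Set where
          coloured-behind : ∀ l → l < k → g ≡ s l → Origin g
          current         : ψ k g ≡ 0 → Origin g
          unchanged       : ψ k g ≡ φ g → Origin g

        origin : ∀ g → Origin g
        origin g with anyUpTo? (λ l → g ≟ s l) (suc k)
        ... | no ¬l = unchanged (elsewhere (λ l l≤k eq → ¬l (l , s≤s l≤k , eq)))
        ... | yes (l , l<1+k , eq) with m≤n⇒m<n∨m≡n (≤-pred l<1+k)
        ... | inj₁ l<k  = coloured-behind l l<k eq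
        ... | inj₂ refl = current (trans (cong (ψ k) eq) uncoloured)

        off-x : ∀ {g} → ¬ Inc x g → ψ k g ≡ φ g
        off-x ¬ig = elsewhere (λ { l _ refl → ¬ig (inc-s l) })

        -- Shifting only hands colours on among the edges at `x`: the new colour of `s l` is the one
        -- `s (suc l)` has in `φ`.
        has-at-x : ∀ {γ} → k ≤ J → γ ≢ 0 → Has (ψ k) x γ → Has φ x γ
        has-at-x k≤J γ≢0 (g , ig , eq) with origin g
        ... | current eq₀   = contradiction (trans (sym eq) eq₀) γ≢0
        ... | unchanged eq′ = g , ig , trans (sym eq′) eq
        ... | coloured-behind l l<k refl = s (suc l) , inc-s (suc l) ,
          trans (colour-s (<-≤-trans l<k k≤J)) (trans (sym (behind l<k)) eq)

        -- A recoloured fan edge at `y l` is parallel to `s l`, so its reserved colour differs from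
        -- that of `s l`.
        missing-ahead : ∀ {l} → k ≤ l → l ≤ J → Missing (ψ k) (y l) (c (s l))
        missing-ahead {l} k≤l l≤J with c-missing (inc-s l)
        ... | γ≢0 , γ≤ , ¬h = γ≢0 , γ≤ , ¬h′
          where
          ¬h′ : ¬ Has (ψ k) (y l) (c (s l))
          ¬h′ (g , ig , eq) with origin g
          ... | current eq₀   = γ≢0 (trans (sym eq) eq₀)
          ... | unchanged eq′ = ¬h (g , ig , trans (sym eq′) eq)
          ... | coloured-behind r r<k refl = distinct (<-≤-trans r<k k≤l) l≤J
            (c-injective (inc-s r) (inc-s l) (sym (other-unique (inc-s r) ig (other≢ x (s l))))
              (trans (sym (behind r<k)) eq))

      open Shifted

      shifted : ∀ k → k ≤ J → Shifted k
      shifted zero _ = record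
        { proper-ψ = proper ; value-ψ = ≤-refl ; uncoloured = φe₀≡0
        ; behind = λ () ; elsewhere = λ _ → refl }
      shifted (suc k) k<J = record
        { proper-ψ   = shift-proper
        ; value-ψ    = ≤-trans (value-ψ prev) shift-value
        ; uncoloured = shift-old
        ; behind     = behind′
        ; elsewhere  = λ g≢ → trans (shift-off (g≢ k (n≤1+n k)) (g≢ (suc k) ≤-refl))
                                    (elsewhere prev (λ l l≤k → g≢ l (≤-trans l≤k (n≤1+n k))))
        }
        where
        prev : Shifted k
        prev = shifted k (<⇒≤ k<J)
        -- The colour `c (s k)` moves from `s (suc k)` to `s k`, which leaves `s (suc k)` as the
        -- uncoloured edge.
        open Shift (proper-ψ prev) (uncoloured prev) (isEdge-other (inc-s k))
                   (missing-ahead prev ≤-refl (<⇒≤ k<J)) (inc-s (suc k))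
                   (trans (ahead prev ≤-refl k<J) (colour-s k<J))
        behind′ : ∀ {l} → l < suc k → ψ (suc k) (s l) ≡ c (s l)
        behind′ {l} l<1+k with m≤n⇒m<n∨m≡n (≤-pred l<1+k)
        ... | inj₂ refl = shift-new
        ... | inj₁ l<k  = trans
          (shift-off (distinct l<k (<⇒≤ k<J)) (distinct l<1+k k<J)) (behind prev l<k)

      weaken : ∀ {k} → k ≤ J → Improvable (value (ψ k)) → Improvable (value φ)
      weaken k≤J (ξ , ξ-proper , ψ<ξ) =
        ξ , ξ-proper , ≤-<-trans (value-ψ (shifted _ k≤J)) ψ<ξ

      module Repeat {i : ℕ} (i<J : i < J) (repeat : c (s i) ≡ c (s J))
                  {α : ℕ} (x-misses-α₀ : Missing φ x α) where

        β : ℕ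
        β = c (s i)

        α≢0 : α ≢ 0
        α≢0 = proj₁ x-misses-α₀

        β≢0 : β ≢ 0
        β≢0 = c≢0 i

        i≤J : i ≤ J
        i≤J = <⇒≤ i<J

        at-i : Shifted i
        at-i = shifted i i≤J

        at-J : Shifted J
        at-J = shifted J ≤-refl

        yᵢ yᵢ₊₁ yJ : Fin n
        yᵢ   = y i
        yᵢ₊₁ = y (suc i)
        yJ   = y J

        x-misses-α : ∀ {k} → k ≤ J → Missing (ψ k) x α
        x-misses-α k≤J = α≢0 , proj₁ (proj₂ x-misses-α₀) ,
          proj₂ (proj₂ x-misses-α₀) ∘ has-at-x (shifted _ k≤J) k≤J α≢0

        yᵢ-misses-β : ¬ Has φ yᵢ β
        yᵢ-misses-β = proj₂ (proj₂ (c-missing (inc-s i)))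

        yJ-misses-β : ¬ Has φ yJ β
        yJ-misses-β = subst (λ γ → ¬ Has φ yJ γ) (sym repeat) (proj₂ (proj₂ (c-missing (inc-s J))))

        yᵢ₊₁-has-β : Has φ yᵢ₊₁ β
        yᵢ₊₁-has-β = s (suc i) , inc-other x (s (suc i)) , colour-s i<J

        -- φ without the edges at x: the part of the colouring on which all ψ k agree.
        χ : Colouring
        χ g with inc? x g
        ... | yes _ = 0
        ... | no _  = φ g

        χ≢0 : ∀ {g} → χ g ≢ 0 → ¬ Inc x g × χ g ≡ φ g
        χ≢0 {g} ≢0 with inc? x g
        ... | yes _  = contradiction refl ≢0
        ... | no ¬ig = ¬ig , refl

        χ-off : ∀ {g} → ¬ Inc x g → χ g ≡ φ g
        χ-off {g} ¬ig with inc? x g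
        ... | yes ig = contradiction ig ¬ig
        ... | no _   = refl

        χ-proper : ProperPartial χ
        χ-proper {v} {g} {h} ig ih eq ≢0 =
          proper ig ih (trans (sym χg) (trans eq χh)) (≢0 ∘ trans χg)
          where
          χg : χ g ≡ φ g
          χg = proj₂ (χ≢0 ≢0)
          χh : χ h ≡ φ h
          χh = proj₂ (χ≢0 (≢0 ∘ trans eq))

        has-χ : ∀ {v γ} → γ ≢ 0 → Has χ v γ → ∃ λ g → Inc v g × ¬ Inc x g × φ g ≡ γ
        has-χ γ≢0 (g , ig , eq) with χ≢0 (λ eq₀ → γ≢0 (trans (sym eq) eq₀))
        ... | ¬ix , χg = g , ig , ¬ix , trans (sym χg) eq

        has-χ-φ : ∀ {v γ} → γ ≢ 0 → Has χ v γ → Has φ v γ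
        has-χ-φ γ≢0 h with has-χ γ≢0 h
        ... | g , ig , _ , eq = g , ig , eq

        has-χ-ψ : ∀ {k v γ} → Shifted k → γ ≢ 0 → Has χ v γ → Has (ψ k) v γ
        has-χ-ψ at-k γ≢0 h with has-χ γ≢0 h
        ... | g , ig , ¬ix , eq = g , ig , trans (off-x at-k ¬ix) eq

        module A = Partner χ χ-proper α≢0
        module B = Partner χ χ-proper β≢0
        -- Since `β` is missing at `yᵢ`, the alternating path of `χ` through `yᵢ` starts there.
        open Chain A.partner B.partner A.partner-involutive B.partner-involutive yᵢ
                   (B.partner-missing (yᵢ-misses-β ∘ has-χ-φ β≢0))

        χ-misses-x : ∀ {γ} → γ ≢ 0 → ¬ Has χ x γ
        χ-misses-x γ≢0 h with has-χ γ≢0 h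
        ... | _ , ix , ¬ix , _ = ¬ix ix

        -- In `χ` no edge at `x` is coloured, so on the path `x` could only be its start `yᵢ`, which
        -- is the far end of an edge at `x`.
        x∉orbit : ¬ Orbit x
        x∉orbit ox = other≢ x (s i) (sym (orbit-isolated ox
          (A.partner-missing (χ-misses-x α≢0)) (B.partner-missing (χ-misses-x β≢0))))

        orbit-misses-β : ∀ {v} → Orbit v → ¬ Has χ v β → v ≡ yᵢ ⊎ v ≡ last
        orbit-misses-β {v} ov ¬h with v ≟ yᵢ | v ≟ last
        ... | yes v≡yᵢ | _        = inj₁ v≡yᵢ
        ... | no _     | yes v≡l  = inj₂ v≡l
        ... | no v≢yᵢ  | no v≢l   = contradiction (B.partner-missing ¬h) (proj₂ (orbit-inner ov v≢yᵢ v≢l))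

        orbit-has-both : ∀ {k v} → Shifted k → Orbit v → v ≢ yᵢ → v ≢ last →
          Has (ψ k) v α × Has (ψ k) v β
        orbit-has-both at-k ov v≢yᵢ v≢l with orbit-inner ov v≢yᵢ v≢l
        ... | a-moves , b-moves =
          has-χ-ψ at-k α≢0 (A.partner-moves a-moves) , has-χ-ψ at-k β≢0 (B.partner-moves b-moves)

        orbit-closed : ∀ {k u v g} → Shifted k → ψ k g ≡ α ⊎ ψ k g ≡ β → ¬ Inc x g →
          Inc u g → Inc v g → Orbit u → Orbit v
        orbit-closed {k} {g = g} at-k eq ¬ix iu iv ou with inc-cases iu iv
        ... | inj₁ refl = ou
        ... | inj₂ refl = Sum.[
          (λ ψg≡α → subst Orbit (A.partner-edge iu (trans χg≡ψg ψg≡α)) (orbit-a ou)) ,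
          (λ ψg≡β → subst Orbit (B.partner-edge iu (trans χg≡ψg ψg≡β)) (orbit-b ou)) ]′ eq
          where
          χg≡ψg : χ g ≡ ψ k g
          χg≡ψg = trans (χ-off ¬ix) (sym (off-x at-k ¬ix))

        -- As `α` is missing at `x`, a chain can pass through `x` only along the `β`-edge `h`.
        ends-at-x : ∀ {k h g u} → k ≤ J → Inc x h → ψ k h ≡ β → Inc x g →
          ψ k g ≡ α ⊎ ψ k g ≡ β → Inc u g → u ≡ x ⊎ u ≡ other x h
        ends-at-x k≤J ih hβ ig (inj₁ gα) iu =
          contradiction (_ , ig , gα) (proj₂ (proj₂ (x-misses-α k≤J)))
        ends-at-x {u = u} k≤J ih hβ ig (inj₂ gβ) iu = inc-cases ih (subst (Inc u)
          (proper-ψ (shifted _ k≤J) ig ih (trans gβ (sym hβ)) (λ eq₀ → β≢0 (trans (sym gβ) eq₀))) iu)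

        -- The `β`-edge of `φ` at `yᵢ₊₁` is `s (suc i)`, which lies at `x` and is uncoloured in `χ`.
        χ-misses-yᵢ₊₁ : ¬ Has χ yᵢ₊₁ β
        χ-misses-yᵢ₊₁ h with has-χ β≢0 h
        ... | g , ig , ¬ix , eq = ¬ix (subst (Inc x) (sym (proper ig (inc-other x (s (suc i)))
          (trans eq (sym (colour-s i<J))) (λ eq₀ → β≢0 (trans (sym eq) eq₀)))) (inc-s (suc i)))

        -- At x, only the β-edge separates the colourings ψ i and ψ J: it is s (suc i) in the
        -- first and s i in the second. If the path of the orbit avoids yᵢ₊₁ it is not joined
        -- to x in ψ i; otherwise it joins x to yᵢ₊₁ in ψ J, and so does not reach yJ.
        avoiding : last ≢ yᵢ₊₁ → Improvable (value (ψ i))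
        avoiding last≢ = kempe-change (proper-ψ at-i) (uncoloured at-i)
          (isEdge-sym (isEdge-other (inc-s i))) (missing-ahead at-i ≤-refl i≤J) (x-misses-α i≤J)
          orbit? closed orbit-start x∉orbit last
          (λ v ov v≢yᵢ v≢l → ×-swap (orbit-has-both at-i ov v≢yᵢ v≢l))
          where
          -- Lacking `β` in `χ`, it could only be an end of the path; it is not `yᵢ`, since only
          -- `yᵢ₊₁` has `β` in `φ`.
          yᵢ₊₁∉orbit : ¬ Orbit yᵢ₊₁
          yᵢ₊₁∉orbit o with orbit-misses-β o χ-misses-yᵢ₊₁
          ... | inj₁ eq = yᵢ-misses-β (subst (λ v → Has φ v β) eq yᵢ₊₁-has-β)
          ... | inj₂ eq = last≢ (sym eq)
          closed′ : ∀ {u v g} → Dec (Inc x g) → ψ i g ≡ α ⊎ ψ i g ≡ β →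
            Inc u g → Inc v g → Orbit u → Orbit v
          closed′ (no ¬ix) eq iu iv ou = orbit-closed at-i eq ¬ix iu iv ou
          closed′ (yes ix) eq iu iv ou = Sum.[
            (λ u≡x → contradiction (subst Orbit u≡x ou) x∉orbit) ,
            (λ u≡yᵢ₊₁ → contradiction (subst Orbit u≡yᵢ₊₁ ou) yᵢ₊₁∉orbit) ]′
            (ends-at-x i≤J (inc-s (suc i)) (trans (ahead at-i ≤-refl i<J) (colour-s i<J)) ix eq iu)
          closed : Closed (ψ i) β α Orbit
          closed {g = g} eq = closed′ (inc? x g) (Sum.swap eq)

        reaching : last ≡ yᵢ₊₁ → Improvable (value (ψ J))
        reaching last≡ = kempe-change (proper-ψ at-J) (uncoloured at-J) (isEdge-other (inc-s J))
          (x-misses-α ≤-refl) (subst (Missing (ψ J) yJ) (sym repeat) (missing-ahead at-J ≤-refl ≤-refl))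
          -- The vertex `x` joins the path because in `ψ J` the edge `s i` between `x` and `yᵢ` is
          -- coloured `β`.
          (λ v → orbit? v ⊎-dec (v ≟ x)) closed (inj₂ refl) yJ∉ last both
          where
          last≢yᵢ : last ≢ yᵢ
          last≢yᵢ eq = yᵢ-misses-β (subst (λ v → Has φ v β) (trans (sym last≡) eq) yᵢ₊₁-has-β)
          yJ∉ : ¬ (Orbit yJ ⊎ yJ ≡ x)
          yJ∉ (inj₂ eq) = other≢ x (s J) eq
          -- Lacking `β`, `yJ` would be an end of the path. If it were `yᵢ`, the parallel edges
          -- `s i` and `s J` would reserve the same colour; the other end, `yᵢ₊₁`, has `β`.
          yJ∉ (inj₁ o) with orbit-misses-β o (yJ-misses-β ∘ has-χ-φ β≢0)
          ... | inj₁ eq = distinct i<J ≤-refl (c-injective (inc-s i) (inc-s J) (sym eq) repeat)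
          ... | inj₂ eq = yJ-misses-β (subst (λ v → Has φ v β) (sym (trans eq last≡)) yᵢ₊₁-has-β)
          closed′ : ∀ {u v g} → Dec (Inc x g) → ψ J g ≡ α ⊎ ψ J g ≡ β →
            Inc u g → Inc v g → Orbit u ⊎ u ≡ x → Orbit v ⊎ v ≡ x
          closed′ (no ¬ix) eq iu iv (inj₁ ou)   = inj₁ (orbit-closed at-J eq ¬ix iu iv ou)
          closed′ (no ¬ix) eq iu iv (inj₂ refl) = contradiction iu ¬ix
          closed′ (yes ix) eq iu iv _ = Sum.[ inj₂ , (λ v≡yᵢ → inj₁ (subst Orbit (sym v≡yᵢ) orbit-start)) ]′
            (ends-at-x ≤-refl (inc-s i) (behind at-J i<J) ix eq iv)
          closed : Closed (ψ J) α β (λ v → Orbit v ⊎ v ≡ x)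
          closed {g = g} = closed′ (inc? x g)
          both : ∀ v → Orbit v ⊎ v ≡ x → v ≢ x → v ≢ last → Has (ψ J) v α × Has (ψ J) v β
          both v (inj₂ v≡x) v≢x _ = contradiction v≡x v≢x
          both v (inj₁ ov) _ v≢l with v ≟ yᵢ
          ... | no v≢yᵢ  = orbit-has-both at-J ov v≢yᵢ v≢l
          -- Here `yᵢ` is an inner vertex: `s i` supplies `β`, and the first step of the path, which
          -- ends elsewhere, supplies `α`.
          ... | yes refl = has-χ-ψ at-J α≢0 (A.partner-moves (start-moves last≢yᵢ)) ,
                           (s i , inc-other x (s i) , behind at-J i<J)

        improve : Improvable (value φ)
        improve with last ≟ yᵢ₊₁
        ... | yes last≡ = weaken ≤-refl (reaching last≡)
        ... | no last≢  = weaken i≤J (avoiding last≢)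

    -- While the fan extends its edges are distinct, and there are only `m` edges.
    stop : ∃ λ J → Stops J × (∀ k → k < J → Extends k)
    stop with first extends-or-stops (suc m)
    ... | inj₂ found   = found
    ... | inj₁ extends with Finₚ.pigeonhole (n<1+n m) (s ∘ toℕ)
    ... | i , j , i<j , eq = contradiction eq (Upto.distinct extends i<j (<⇒≤ (toℕ<n j)))

    improve : Improvable (value φ)
    improve with stop
    ... | J , inj₂ (i , i<J , repeat) , extends =
      Upto.Repeat.improve extends i<J repeat (proj₂ missing-at-x)
    -- The colour reserved for the last fan edge is absent at `x` and, after the shifts, still free
    -- at both ends.
    ... | J , inj₁ ¬next , extends = weaken ≤-refl (colour-edge (proper-ψ at-J) (uncoloured at-J)
            (isEdge-other (inc-s J)) (¬next ∘ has-at-x at-J ≤-refl (c≢0 J))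
            (missing-ahead at-J ≤-refl ≤-refl))
      where
      open Upto extends
      open Shifted
      at-J : Shifted J
      at-J = shifted J ≤-refl

-- Raising the value until every edge is coloured locally.

module LocalColouring {n m : ℕ} (G : MultiGraph n m) where
  open MultiGraph G
  open Incidence G
  open PartialColouring G

  Good : Colouring → Fin m → Set
  Good φ e = φ e ≢ 0 × φ e ≤ bound (end₁ e) ⊔ bound (end₂ e)

  -- An edge that violates locality is first erased without lowering the value, and the fan is then
  -- grown from it.
  improve-at : ∀ {φ} → ProperPartial φ → ∀ e → ¬ Good φ e → Improvable (value φ)
  improve-at {φ} proper e bad with φ e ℕₚ.≟ 0
  ... | yes φe≡0 = Fan.At.improve G proper φe≡0
  ... | no φe≢0 with erase-large proper large
    where
    large : ∀ {u} → Inc u e → bound u < φ e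
    large (inj₁ refl) = ≰⇒> (λ le → bad (φe≢0 , ≤-trans le (m≤m⊔n _ _)))
    large (inj₂ refl) = ≰⇒> (λ le → bad (φe≢0 , ≤-trans le (m≤n⊔m _ _)))
  ...   | proper₀ , le with Fan.At.improve G proper₀ (update-at φ e 0)
  ...     | ψ , ψ-proper , lt = ψ , ψ-proper , ≤-<-trans le lt

  value-bounded : ∀ φ → value φ ≤ sumFin n bound
  value-bounded φ = sumFin-mono n λ v → ≤-trans (m≤m+n _ _)
    (≤-reflexive (count-complement (hasSmall? φ v)))

  good? : ∀ φ e → Dec (Good φ e)
  good? φ e = ¬? (φ e ℕₚ.≟ 0) ×-dec (φ e ≤? _)

  -- Each round trades one unit of `fuel` for at least one unit of `value`, which cannot exceed the
  -- sum of the bounds.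
  exhaust : ∀ fuel φ → ProperPartial φ → sumFin n bound < fuel + value φ →
    ∃ λ ψ → ProperPartial ψ × ∀ e → Good ψ e
  exhaust zero φ proper lt = contradiction (value-bounded φ) (<⇒≱ lt)
  exhaust (suc fuel) φ proper lt with Finₚ.all? (good? φ)
  ... | yes good = φ , proper , good
  ... | no ¬good with Finₚ.¬∀⟶∃¬ m (Good φ) (good? φ) ¬good
  ... | e , bad with improve-at proper e bad
  ... | ψ , ψ-proper , φ<ψ = exhaust fuel ψ ψ-proper (≤-trans lt
    (≤-trans (≤-reflexive (sym (+-suc fuel (value φ)))) (+-monoʳ-≤ fuel φ<ψ)))

  local-colouring : Σ (Fin m → ℕ) (λ φ → Positive G φ × Proper G φ × Local G φ)
  -- The start is the empty colouring, with fuel one above the largest possible value.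
  local-colouring with exhaust (suc (sumFin n bound)) (const 0)
                         (λ _ _ _ ≢0 → contradiction refl ≢0) (s≤s (m≤m+n _ _))
  ... | φ , proper , good =
    φ , (λ e → n≢0⇒n>0 (proj₁ (good e))) , φ-proper , (λ e → proj₂ (good e))
    where
    meet : ∀ {e f} → shareEnd G e f → ∃ λ v → Inc v e × Inc v f
    meet (inj₁ eq)               = _ , inj₁ eq , inj₁ refl
    meet (inj₂ (inj₁ eq))        = _ , inj₁ eq , inj₂ refl
    meet (inj₂ (inj₂ (inj₁ eq))) = _ , inj₂ eq , inj₁ refl
    meet (inj₂ (inj₂ (inj₂ eq))) = _ , inj₂ eq , inj₂ refl
    φ-proper : Proper G φ
    φ-proper e f e≢f share eq with meet share
    ... | _ , ie , if = e≢f (proper ie if eq (proj₁ (good e)))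

theorem1p1 : (n m : ℕ) (G : MultiGraph n m) →
    Σ (Fin m → ℕ) (λ φ → Positive G φ × Proper G φ × Local G φ)
theorem1p1 n m G = LocalColouring.local-colouring G
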